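{- Let $R$ be a ring (unital and associative, not necessarily commutative). Let $n\in\mathbb{N}$ and $p\in\{0,1,\ldots,n\}$. Let $h_{k,\,i}$ be an element of $R$ for all $k\in\mathbb{Z}$ and $i\in[n]$. For any $\alpha\in\mathbb{Z}^n$, define $$t_\alpha:=\operatorname{rowdet}\left(\left(h_{\alpha_i+j,\,i}\right)_{i,j\in[n]}\right)\in R.$$ Let $\xi$ be the $n$-tuple $$(1,2,\ldots,n)+(\underbrace{0,0,\ldots,0}_{n-p\text{ zeroes}},\underbrace{1,1,\ldots,1}_{p\text{ ones}})=(1,2,\ldots,n-p,\,n-p+2,\,n-p+3,\ldots,n+1)\in\mathbb{Z}^n.$$ Let $\alpha\in\mathbb{Z}^n$. Then $$\sum_{\substack{\beta\in\{0,1\}^n;\\ |\beta|=p}}t_{\alpha+\beta}=\operatorname{rowdet}\left(\left(h_{\alpha_i+\xi_j,\,i}\right)_{i,j\in[n]}\right).$$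
   Context: $\mathbb{N}=\{0,1,2,\ldots\}$ and $[n]=\{1,2,\ldots,n\}$. For an $n$-tuple $\alpha$, $\alpha_i$ denotes its $i$-th entry, and for $\alpha\in\mathbb{Z}^n$ we set $|\alpha|:=\alpha_1+\alpha_2+\cdots+\alpha_n$. Addition of $n$-tuples is entrywise. $S_n$ is the group of permutations of $[n]$, and $(-1)^\sigma$ is the sign of $\sigma\in S_n$. For an $n\times n$-matrix $A=(a_{i,j})_{i,j\in[n]}$ over $R$ (whose $(i,j)$-th entry is $a_{i,j}$), the row-determinant is $$\operatorname{rowdet}A:=\sum_{\sigma\in S_n}(-1)^\sigma a_{1,\sigma(1)}a_{2,\sigma(2)}\cdots a_{n,\sigma(n)}\in R$$ (factors multiplied in this order). -}

module Defs where

open import Algebra.Bundles using (Ring; Semiring)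
import Algebra.Definitions.RawMonoid as RawMonoidDefs
import Algebra.Definitions.RawSemiring as RawSemiringDefs
open import Data.Fin.Base using (Fin; zero; suc; toℕ; punchIn; cast)
open import Data.Fin.Properties using (_<?_; punchIn-injective)
open import Data.Fin.Permutation
  using (Permutation′; _⟨$⟩ʳ_; insert; remove; insert-remove; insert-punchIn; id)
  renaming (_≈_ to _≈ₚ_)
open import Data.Integer.Base as ℤ using (ℤ; 0ℤ; 1ℤ)
import Data.Integer.Properties as ℤ
open import Data.List.Base as List
  using (List; []; _∷_; allFin; cartesianProduct; cartesianProductWith; filter; foldr; map)
import Data.List.Membership.Setoid as Membership
import Data.List.Membership.Setoid.Properties as MembershipP
open import Data.List.Membership.Propositional.Properties using (∈-allFin)
open import Data.List.Relation.Unary.All as All using (All)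
open import Data.List.Relation.Unary.AllPairs as AllPairs using (AllPairs)
open import Data.List.Relation.Unary.Any using (here)
import Data.List.Relation.Unary.Unique.Setoid as UniqueS
import Data.List.Relation.Unary.Unique.Setoid.Properties as UniqueP
open import Data.List.Relation.Unary.Unique.Propositional.Properties using (allFin⁺)
open import Data.Nat.Base using (ℕ; zero; suc; _∸_; _≤_)
open import Data.Nat.Properties using (m∸n+n≡m)
open import Data.Product.Base using (_×_; _,_)
open import Data.Vec.Functional as Vector using (Vector; replicate; rearrange; zipWith; _++_)
open import Level using (0ℓ)
open import Relation.Binary.Bundles using (Setoid)
open import Relation.Binary.PropositionalEquality
  using (_≡_; refl; sym; trans; cong; setoid)
open import Relation.Nullary.Decidable using (_×-dec_)

-- The element i ∈ [n] is represented by the element of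
-- Fin n whose toℕ is i - 1.

infixl 6 _⊕_

_⊕_ : ∀ {n} → Vector ℤ n → Vector ℤ n → Vector ℤ n
_⊕_ = zipWith ℤ._+_

∣_∣ : ∀ {n} → Vector ℤ n → ℤ
∣_∣ = RawMonoidDefs.sum ℤ.+-0-rawMonoid

1⋯_ : ∀ n → Vector ℤ n
(1⋯ n) i = ℤ.+ suc (toℕ i)

-- (0, …, 0, 1, …, 1) naturally has length (n ∸ p) + p; the cast only
-- identifies Fin n with Fin ((n ∸ p) + p).
ξ : ∀ n p → p ≤ n → Vector ℤ n
ξ n p p≤n = (1⋯ n) ⊕
  rearrange (cast (sym (m∸n+n≡m p≤n))) (replicate (n ∸ p) 0ℤ ++ replicate p 1ℤ)

tuples : ∀ {A : Set} → List A → ∀ n → List (Vector A n)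
tuples xs zero    = Vector.[] ∷ []
tuples xs (suc n) = cartesianProductWith Vector._∷_ xs (tuples xs n)

binaryTuplesOfSum : ∀ n → ℕ → List (Vector ℤ n)
binaryTuplesOfSum n p = filter (λ β → ∣ β ∣ ℤ.≟ ℤ.+ p) (tuples (0ℤ ∷ 1ℤ ∷ []) n)

-- Every permutation of Fin n occurs exactly once up to pointwise equality:
-- see permutations-complete and permutations-unique.
permutations : ∀ n → List (Permutation′ n)
permutations zero    = id ∷ []
permutations (suc n) = cartesianProductWith (insert zero) (allFin (suc n)) (permutations n)

inversions : ∀ {n} → Permutation′ n → List (Fin n × Fin n)
inversions {n} σ =
  filter (λ (i , j) → (i <? j) ×-dec ((σ ⟨$⟩ʳ j) <? (σ ⟨$⟩ʳ i)))
         (cartesianProduct (allFin n) (allFin n))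

permutationSetoid : ℕ → Setoid 0ℓ 0ℓ
permutationSetoid n = record
  { Carrier       = Permutation′ n
  ; _≈_           = _≈ₚ_
  ; isEquivalence = record
    { refl  = λ _ → refl
    ; sym   = λ p i → sym (p i)
    ; trans = λ p q i → trans (p i) (q i)
    }
  }

private
  insert-cong : ∀ {n} {j k} {π ρ : Permutation′ n} → j ≡ k → π ≈ₚ ρ →
                insert zero j π ≈ₚ insert zero k ρ
  insert-cong         refl p zero    = refl
  insert-cong {j = j} refl p (suc i) = cong (punchIn j) (p i)

  insert-injective : ∀ {n} {j k} {π ρ : Permutation′ n} →
                     insert zero j π ≈ₚ insert zero k ρ → j ≡ k × π ≈ₚ ρ
  insert-injective {j = j} {k} {π} {ρ} p with refl ← p zero =
    refl , λ i → punchIn-injective j _ _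
      (trans (sym (insert-punchIn zero j π i))
             (trans (p (suc i)) (insert-punchIn zero j ρ i)))

permutations-complete : ∀ n (π : Permutation′ n) →
  Membership._∈_ (permutationSetoid n) π (permutations n)
permutations-complete zero    π = here λ ()
permutations-complete (suc n) π =
  MembershipP.∈-resp-≈ (permutationSetoid (suc n))
    {x = insert zero (π ⟨$⟩ʳ zero) (remove zero π)} {y = π} (insert-remove zero π)
    (MembershipP.∈-cartesianProductWith⁺
      (setoid (Fin (suc n))) (permutationSetoid n) (permutationSetoid (suc n))
      (λ {_} {_} {π} {ρ} → insert-cong {π = π} {ρ})
      (∈-allFin (π ⟨$⟩ʳ zero))
      (permutations-complete n (remove zero π)))

permutations-unique : ∀ n → UniqueS.Unique (permutationSetoid n) (permutations n)
permutations-unique zero    = All.[] AllPairs.∷ AllPairs.[]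
permutations-unique (suc n) = UniqueP.cartesianProductWith⁺
  (setoid (Fin (suc n))) (permutationSetoid n) (permutationSetoid (suc n))
  (insert zero) (λ {_} {_} {π} {ρ} → insert-injective {π = π} {ρ})
  (allFin⁺ (suc n)) (permutations-unique n)

module RowDeterminant {c ℓ} (R : Ring c ℓ) where

  open Ring R
  open RawSemiringDefs (Semiring.rawSemiring semiring) using (_^_)

  infixl 10 listSum

  listSum : ∀ {a} {A : Set a} → List A → (A → Carrier) → Carrier
  listSum xs f = foldr _+_ 0# (map f xs)

  syntax listSum xs (λ x → e) = ∑[ x ∈ xs ] e

  -- The product x₁ x₂ ⋯ xₙ with the factors in this order.
  orderedProduct : ∀ {n} → Vector Carrier n → Carrier
  orderedProduct = Vector.foldr _*_ 1#

  sgn : ∀ {n} → Permutation′ n → Carrier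
  sgn σ = (- 1#) ^ List.length (inversions σ)

  rowdet : ∀ {n} → (Fin n → Fin n → Carrier) → Carrier
  rowdet {n} A =
    ∑[ σ ∈ permutations n ] (sgn σ * orderedProduct (λ i → A i (σ ⟨$⟩ʳ i)))

  t : ∀ {n} → (ℤ → Fin n → Carrier) → Vector ℤ n → Carrier
  t {n} h α = rowdet (λ i j → h (α i ℤ.+ (1⋯ n) j) i)

-- In the sum over β of the expanded row-determinants, the substitution β = γ ∘ σ (for each
-- permutation σ separately) turns the shifts of the rows into shifts of the columns: the sum becomes
-- the sum over γ of rowdet (h (αᵢ + j + γⱼ) i).  If γ has an entry 1 directly followed by an entry 0,
-- this matrix has two equal adjacent columns, so its row-determinant vanishes, as Laplace expansion
-- along the first row shows by induction even over a noncommutative ring.  The only γ of sum p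
-- without such a descent is (0,…,0,1,…,1), for which j + γⱼ = ξⱼ.

module Submission where

open import Algebra.Bundles using (Ring)
import Algebra.Properties.CommutativeMonoid.Sum as Sum
open import Data.Bool.Base using (if_then_else_)
open import Data.Fin.Base using (Fin; zero; suc; toℕ; punchIn; cast; splitAt; _<_)
open import Data.Fin.Permutation
  using (Permutation′; _⟨$⟩ʳ_; insert; remove; punchIn-permute)
open import Data.Fin.Properties as Fin using (_<?_; punchIn-mono-≤; punchIn-cancel-≤)
open import Data.Integer.Base as ℤ using (ℤ; 0ℤ; 1ℤ)
import Data.Integer.Properties as ℤ
open import Data.List.Base as List
  using (List; []; _∷_; length; filter; tabulate; allFin; cartesianProduct; cartesianProductWith)
import Data.List.Properties as List
open import Data.Nat.Base as ℕ using (ℕ; zero; suc; _∸_; _≤_; z≤n; s≤s)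
import Data.Nat.Properties as ℕ
open import Data.Product.Base using (_×_; _,_; proj₂; ∃₂)
open import Data.Sum.Base using (_⊎_; inj₁; inj₂)
open import Data.Vec.Functional as Vector using (Vector; replicate; rearrange; insertAt)
import Data.Vec.Functional.Properties as Vector
open import Function.Base using (_∘_; id)
open import Function.Bundles using (mk⇔)
open import Relation.Binary.PropositionalEquality
  using (_≡_; _≢_; _≗_; refl; sym; trans; cong; cong₂; module ≡-Reasoning)
open import Relation.Nullary.Decidable using (Dec; yes; no; does; _×-dec_; does-⇔)
open import Relation.Nullary.Negation using (contradiction)
open import Relation.Unary using (Decidable)
open import Defs

-- Inversions of a permutation with a prescribed first value.

module ℕΣ = Sum ℕ.+-0-commutativeMonoid

-- Indicator values turn the length of a filtered list into a sum, which can then be split by rows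
-- and reindexed along a permutation.
𝟙 : ∀ {p} {P : Set p} → Dec P → ℕ
𝟙 P? = if does P? then 1 else 0

𝟙-cong : ∀ {p q} {P : Set p} {Q : Set q} (P? : Dec P) (Q? : Dec Q) →
         (P → Q) → (Q → P) → 𝟙 P? ≡ 𝟙 Q?
𝟙-cong P? Q? to from = cong (if_then 1 else 0) (does-⇔ (mk⇔ to from) P? Q?)

length-filter-tabulate : ∀ {a p} {A : Set a} {P : A → Set p} (P? : Decidable P) →
  ∀ {n} (f : Fin n → A) → length (filter P? (tabulate f)) ≡ ℕΣ.sum (λ i → 𝟙 (P? (f i)))
length-filter-tabulate P? {zero}  f = refl
length-filter-tabulate P? {suc n} f with P? (f zero)
... | yes _ = cong suc (length-filter-tabulate P? (f ∘ suc))
... | no  _ = length-filter-tabulate P? (f ∘ suc)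

length-filter-cartesianProduct : ∀ {a b p} {A : Set a} {B : Set b} {P : A × B → Set p}
  (P? : Decidable P) → ∀ {m n} (f : Fin m → A) (g : Fin n → B) →
  length (filter P? (cartesianProduct (tabulate f) (tabulate g))) ≡
  ℕΣ.sum (λ i → ℕΣ.sum (λ j → 𝟙 (P? (f i , g j))))
length-filter-cartesianProduct P? {zero}  f g = refl
length-filter-cartesianProduct P? {suc m} f g = begin
  length (filter P? (List.map (f zero ,_) (tabulate g) List.++ rest))
    ≡⟨ cong length (List.filter-++ P? (List.map (f zero ,_) (tabulate g)) rest) ⟩
  length (filter P? (List.map (f zero ,_) (tabulate g)) List.++ filter P? rest)
    ≡⟨ List.length-++ (filter P? (List.map (f zero ,_) (tabulate g))) ⟩
  length (filter P? (List.map (f zero ,_) (tabulate g))) ℕ.+ length (filter P? rest)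
    ≡⟨ cong (λ xs → length (filter P? xs) ℕ.+ length (filter P? rest)) (List.map-tabulate g (f zero ,_)) ⟩
  length (filter P? (tabulate (λ j → f zero , g j))) ℕ.+ length (filter P? rest)
    ≡⟨ cong₂ ℕ._+_ (length-filter-tabulate P? (λ j → f zero , g j))
                 (length-filter-cartesianProduct P? (f ∘ suc) g) ⟩
  ℕΣ.sum (λ i → ℕΣ.sum (λ j → 𝟙 (P? (f i , g j)))) ∎
  where
  open ≡-Reasoning
  rest = cartesianProduct (tabulate (f ∘ suc)) (tabulate g)

punchIn-mono-< : ∀ {n} (i : Fin (suc n)) (j k : Fin n) → j < k → punchIn i j < punchIn i k
punchIn-mono-< i j k j<k =
  ℕ.≰⇒> (λ k≤j → ℕ.<⇒≱ j<k (punchIn-cancel-≤ i k j k≤j))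

punchIn-cancel-< : ∀ {n} (i : Fin (suc n)) (j k : Fin n) → punchIn i j < punchIn i k → j < k
punchIn-cancel-< i j k p<q = ℕ.≰⇒> (λ k≤j → ℕ.<⇒≱ p<q (punchIn-mono-≤ i k j k≤j))

-- `punchIn j` enumerates every index except `j`, so its values below `j` are all the `toℕ j`
-- indices smaller than `j`.
count-punchIn-< : ∀ {n} (j : Fin (suc n)) → ℕΣ.sum (λ k → 𝟙 (punchIn j k <? j)) ≡ toℕ j
count-punchIn-< {n}     zero    = ℕΣ.sum-replicate-zero n
count-punchIn-< {suc n} (suc j) = cong suc (trans
  (ℕΣ.sum-cong-≗ λ k → 𝟙-cong (suc (punchIn j k) <? suc j) (punchIn j k <? j) ℕ.s≤s⁻¹ s≤s)
  (count-punchIn-< j))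

inv? : ∀ {n} (σ : Permutation′ n) (i j : Fin n) → Dec (i < j × (σ ⟨$⟩ʳ j) < (σ ⟨$⟩ʳ i))
inv? σ i j = (i <? j) ×-dec ((σ ⟨$⟩ʳ j) <? (σ ⟨$⟩ʳ i))

-- Position `zero` carries the value `j` and forms an inversion with each smaller value. Among the
-- other positions `punchIn j` keeps the order of the values of `π`, hence also its inversions. This
-- gives the signs in the Laplace expansion.
length-inversions-insert : ∀ {n} (j : Fin (suc n)) (π : Permutation′ n) →
  length (inversions (insert zero j π)) ≡ toℕ j ℕ.+ length (inversions π)
length-inversions-insert {n} j π = begin
  length (inversions σ)
    ≡⟨ length-filter-cartesianProduct (λ (i , k) → inv? σ i k) id id ⟩
  -- The pairs with second position `zero` have dropped out by computation, since no index lies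
  -- below `zero`.
  ℕΣ.sum (λ k → 𝟙 (inv? σ zero (suc k))) ℕ.+
  ℕΣ.sum (λ i → ℕΣ.sum (λ k → 𝟙 (inv? σ (suc i) (suc k))))
    ≡⟨ cong₂ ℕ._+_ (ℕΣ.sum-cong-≗ firstRow) (ℕΣ.sum-cong-≗ λ i → ℕΣ.sum-cong-≗ (otherRow i)) ⟩
  ℕΣ.sum (λ k → 𝟙 (punchIn j (π ⟨$⟩ʳ k) <? j)) ℕ.+ ℕΣ.sum (λ i → ℕΣ.sum (λ k → 𝟙 (inv? π i k)))
    ≡⟨ cong₂ ℕ._+_ (ℕΣ.sum-permute (λ k → 𝟙 (punchIn j k <? j)) π)
                 (length-filter-cartesianProduct (λ (i , k) → inv? π i k) id id) ⟨
  ℕΣ.sum (λ k → 𝟙 (punchIn j k <? j)) ℕ.+ length (inversions π)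
    ≡⟨ cong (ℕ._+ length (inversions π)) (count-punchIn-< j) ⟩
  toℕ j ℕ.+ length (inversions π) ∎
  where
  open ≡-Reasoning
  σ = insert zero j π

  firstRow : ∀ k → 𝟙 (inv? σ zero (suc k)) ≡ 𝟙 (punchIn j (π ⟨$⟩ʳ k) <? j)
  firstRow k = 𝟙-cong (inv? σ zero (suc k)) (punchIn j (π ⟨$⟩ʳ k) <? j) proj₂ (s≤s z≤n ,_)

  otherRow : ∀ i k → 𝟙 (inv? σ (suc i) (suc k)) ≡ 𝟙 (inv? π i k)
  otherRow i k = 𝟙-cong (inv? σ (suc i) (suc k)) (inv? π i k)
    (λ (i<k , lt) → ℕ.s≤s⁻¹ i<k , punchIn-cancel-< j _ _ lt)
    (λ (i<k , lt) → s≤s i<k , punchIn-mono-< j _ _ lt)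

-- Adjacent indices, deletion of a column, and descents of tuples.

data Adjacent : ∀ {n} → Fin n → Fin n → Set where
  here  : ∀ {n} → Adjacent {suc (suc n)} zero (suc zero)
  there : ∀ {n} {i j : Fin n} → Adjacent i j → Adjacent (suc i) (suc j)

toℕ-adjacent : ∀ {n} {i j : Fin n} → Adjacent i j → toℕ j ≡ suc (toℕ i)
toℕ-adjacent here      = refl
toℕ-adjacent (there a) = cong suc (toℕ-adjacent a)

-- What deleting column `k` does to a pair of adjacent columns: either `k` is one of the two, or
-- both survive and are still adjacent in the minor.
data AdjacentAfter {n} (k : Fin (suc n)) : Fin (suc n) → Fin (suc n) → Set where
  isLeft  : ∀ {j} → AdjacentAfter k k j
  isRight : ∀ {i} → AdjacentAfter k i k
  avoids  : ∀ {i j} → Adjacent i j → AdjacentAfter k (punchIn k i) (punchIn k j)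

adjacentAfter : ∀ {n} (k : Fin (suc n)) {i j} → Adjacent i j → AdjacentAfter k i j
adjacentAfter zero          here                = isLeft
adjacentAfter (suc zero)    here                = isRight
adjacentAfter {suc (suc _)} (suc (suc k)) here   = avoids here
adjacentAfter zero        (there a) = avoids a
adjacentAfter {suc n} (suc k) (there a) with adjacentAfter k a
... | isLeft   = isLeft
... | isRight  = isRight
... | avoids b = avoids (there b)

-- Deleting column `i` or its neighbour `j` leaves the same columns in the same order, except at one
-- place, where the first minor has `j` and the second has `i`. If columns `i` and `j` are equal,
-- the minors therefore agree.
punchIn-adjacent : ∀ {n} {i j : Fin (suc n)} → Adjacent i j → ∀ k →
  punchIn i k ≡ punchIn j k ⊎ punchIn i k ≡ j × punchIn j k ≡ i
punchIn-adjacent here      zero    = inj₂ (refl , refl)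
punchIn-adjacent here      (suc k) = inj₁ refl
punchIn-adjacent (there a) zero    = inj₁ refl
punchIn-adjacent (there a) (suc k) with punchIn-adjacent a k
... | inj₁ eq        = inj₁ (cong suc eq)
... | inj₂ (eq , eq′) = inj₂ (cong suc eq , cong suc eq′)

-- The prescribed sum is an integer because splitting off an entry 1 replaces `q` by `ℤ.pred q`,
-- which is negative for `q` = 0.
binaryTuples : ∀ n → ℤ → List (Vector ℤ n)
binaryTuples n q = filter (λ β → ∣ β ∣ ℤ.≟ q) (tuples (0ℤ ∷ 1ℤ ∷ []) n)

HasDescent : ∀ {n} → Vector ℤ n → Set
HasDescent γ = ∃₂ λ i j → Adjacent i j × γ i ≡ 1ℤ × γ j ≡ 0ℤ

∷-hasDescent : ∀ {n} b {γ : Vector ℤ n} → HasDescent γ → HasDescent (b Vector.∷ γ)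
∷-hasDescent b (i , j , a , γi≡1 , γj≡0) = suc i , suc j , there a , γi≡1 , γj≡0

∷-≗ : ∀ {a n} {A : Set a} (x : A) {xs ys : Vector A n} → xs ≗ ys → (x Vector.∷ xs) ≗ (x Vector.∷ ys)
∷-≗ x = Vector.∷-cong refl

insertAt-suc : ∀ {a n} {A : Set a} (x : A) (xs : Vector A n) j y →
  insertAt (x Vector.∷ xs) (suc j) y ≗ (x Vector.∷ insertAt xs j y)
insertAt-suc x xs j y zero    = refl
insertAt-suc x xs j y (suc i) = refl

-- This carries the induction for the substitution by `σ`: position `zero` is sent to the inserted
-- entry, and the other positions are permuted by `remove zero σ`.
insertAt-permute : ∀ {a n} {A : Set a} (σ : Permutation′ (suc n)) (xs : Vector A n) y →
  (insertAt xs (σ ⟨$⟩ʳ zero) y ∘ (σ ⟨$⟩ʳ_)) ≗ (y Vector.∷ (xs ∘ (remove zero σ ⟨$⟩ʳ_)))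
insertAt-permute σ xs y zero    = Vector.insertAt-lookup xs (σ ⟨$⟩ʳ zero) y
insertAt-permute σ xs y (suc i) = trans
  (cong (insertAt xs (σ ⟨$⟩ʳ zero) y) (punchIn-permute σ zero i))
  (Vector.insertAt-punchIn xs (σ ⟨$⟩ʳ zero) y (remove zero σ ⟨$⟩ʳ i))

pred-sum : ∀ x {q} → 1ℤ ℤ.+ x ≡ q → x ≡ ℤ.pred q
pred-sum x refl = sym (ℤ.pred-suc x)

suc-sum : ∀ {x} q → x ≡ ℤ.pred q → 1ℤ ℤ.+ x ≡ q
suc-sum q refl = ℤ.suc-pred q

module _ {c ℓ} (R : Ring c ℓ) where

  private
    module R = Ring R
  open Ring R
    using (Carrier; _≈_; _+_; _*_; -_; 0#; 1#; +-cong; +-congˡ; +-congʳ; *-cong; *-congˡ; *-congʳ)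
  open RowDeterminant R
  open import Algebra.Properties.Ring R using (-1*x≈-x; -‿distribʳ-*; -‿involutive)
  open import Algebra.Properties.CommutativeSemigroup R.+-commutativeSemigroup
    using () renaming (interchange to +-interchange)
  open import Algebra.Properties.Semiring.Exp R.semiring using (_^_; ^-homo-*; ^-congʳ)
  open import Algebra.Properties.Semiring.Sum R.semiring using (sum; sum-cong-≋; sum-replicate-zero)
  open import Relation.Binary.Reasoning.Setoid R.setoid

  -- Finite sums over lists in `R`.

  listSum-cong : ∀ {a} {A : Set a} (xs : List A) {f g : A → Carrier} →
    (∀ x → f x ≈ g x) → listSum xs f ≈ listSum xs g
  listSum-cong []       f≈g = R.refl
  listSum-cong (x ∷ xs) f≈g = +-cong (f≈g x) (listSum-cong xs f≈g)

  listSum-zero : ∀ {a} {A : Set a} (xs : List A) → listSum xs (λ _ → 0#) ≈ 0#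
  listSum-zero []       = R.refl
  listSum-zero (x ∷ xs) = R.trans (R.+-identityˡ _) (listSum-zero xs)

  listSum-≈0 : ∀ {a} {A : Set a} (xs : List A) {f : A → Carrier} →
    (∀ x → f x ≈ 0#) → listSum xs f ≈ 0#
  listSum-≈0 xs f≈0 = R.trans (listSum-cong xs f≈0) (listSum-zero xs)

  listSum-+ : ∀ {a} {A : Set a} (xs : List A) (f g : A → Carrier) →
    listSum xs (λ x → f x + g x) ≈ listSum xs f + listSum xs g
  listSum-+ []       f g = R.sym (R.+-identityˡ 0#)
  listSum-+ (x ∷ xs) f g =
    R.trans (+-congˡ (listSum-+ xs f g)) (+-interchange (f x) (g x) _ _)

  listSum-comm : ∀ {a b} {A : Set a} {B : Set b} (xs : List A) (ys : List B) (f : A → B → Carrier) →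
    (∑[ x ∈ xs ] ∑[ y ∈ ys ] f x y) ≈ (∑[ y ∈ ys ] ∑[ x ∈ xs ] f x y)
  listSum-comm []       ys f = R.sym (listSum-zero ys)
  listSum-comm (x ∷ xs) ys f =
    R.trans (+-congˡ (listSum-comm xs ys f)) (R.sym (listSum-+ ys (f x) _))

  *-distribˡ-listSum : ∀ {a} {A : Set a} (xs : List A) x (f : A → Carrier) →
    x * listSum xs f ≈ (∑[ y ∈ xs ] (x * f y))
  *-distribˡ-listSum []       x f = R.zeroʳ x
  *-distribˡ-listSum (y ∷ xs) x f =
    R.trans (R.distribˡ x (f y) _) (+-congˡ (*-distribˡ-listSum xs x f))

  listSum-++ : ∀ {a} {A : Set a} (xs ys : List A) (f : A → Carrier) →
    listSum (xs List.++ ys) f ≈ listSum xs f + listSum ys f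
  listSum-++ []       ys f = R.sym (R.+-identityˡ _)
  listSum-++ (x ∷ xs) ys f = R.trans (+-congˡ (listSum-++ xs ys f)) (R.sym (R.+-assoc _ _ _))

  listSum-map : ∀ {a b} {A : Set a} {B : Set b} (g : A → B) (xs : List A) (f : B → Carrier) →
    listSum (List.map g xs) f ≈ listSum xs (f ∘ g)
  listSum-map g []       f = R.refl
  listSum-map g (x ∷ xs) f = +-congˡ (listSum-map g xs f)

  listSum-tabulate : ∀ {a} {A : Set a} {n} (g : Fin n → A) (f : A → Carrier) →
    listSum (tabulate g) f ≈ sum (f ∘ g)
  listSum-tabulate {n = zero}  g f = R.refl
  listSum-tabulate {n = suc n} g f = +-congˡ (listSum-tabulate (g ∘ suc) f)

  listSum-cartesianProductWith : ∀ {a b d} {A : Set a} {B : Set b} {D : Set d}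
    (g : A → B → D) (xs : List A) (ys : List B) (f : D → Carrier) →
    listSum (cartesianProductWith g xs ys) f ≈ (∑[ x ∈ xs ] ∑[ y ∈ ys ] f (g x y))
  listSum-cartesianProductWith g []       ys f = R.refl
  listSum-cartesianProductWith g (x ∷ xs) ys f = R.trans
    (listSum-++ (List.map (g x) ys) _ f)
    (+-cong (listSum-map (g x) ys f) (listSum-cartesianProductWith g xs ys f))

  listSum-filter-map : ∀ {a b p q} {A : Set a} {B : Set b} {P : B → Set p} {Q : A → Set q}
    (P? : Decidable P) (Q? : Decidable Q) (g : A → B) →
    (∀ {x} → P (g x) → Q x) → (∀ {x} → Q x → P (g x)) →
    ∀ xs (f : B → Carrier) → listSum (filter P? (List.map g xs)) f ≈ listSum (filter Q? xs) (f ∘ g)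
  listSum-filter-map P? Q? g P⇒Q Q⇒P []       f = R.refl
  listSum-filter-map P? Q? g P⇒Q Q⇒P (x ∷ xs) f with P? (g x) | Q? x
  ... | yes _ | yes _  = +-congˡ (listSum-filter-map P? Q? g P⇒Q Q⇒P xs f)
  ... | no _  | no _   = listSum-filter-map P? Q? g P⇒Q Q⇒P xs f
  ... | yes p | no ¬q  = contradiction (P⇒Q p) ¬q
  ... | no ¬p | yes q  = contradiction (Q⇒P q) ¬p

  -- Splitting and reindexing sums over binary tuples.

  ∑-binaryTuples-suc : ∀ n q (f : Vector ℤ (suc n) → Carrier) →
    listSum (binaryTuples (suc n) q) f ≈
    listSum (binaryTuples n q) (f ∘ (0ℤ Vector.∷_)) +
    listSum (binaryTuples n (ℤ.pred q)) (f ∘ (1ℤ Vector.∷_))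
  ∑-binaryTuples-suc n q f = begin
    listSum (filter P? (zeros List.++ (ones List.++ []))) f
      ≡⟨ cong (λ xs → listSum (filter P? (zeros List.++ xs)) f) (List.++-identityʳ ones) ⟩
    listSum (filter P? (zeros List.++ ones)) f
      ≡⟨ cong (λ xs → listSum xs f) (List.filter-++ P? zeros ones) ⟩
    listSum (filter P? zeros List.++ filter P? ones) f
      ≈⟨ listSum-++ (filter P? zeros) (filter P? ones) f ⟩
    listSum (filter P? zeros) f + listSum (filter P? ones) f
      ≈⟨ +-cong
           (listSum-filter-map P? (λ β → ∣ β ∣ ℤ.≟ q) (0ℤ Vector.∷_)
             (trans (sym (ℤ.+-identityˡ _))) (trans (ℤ.+-identityˡ _)) T f)
           (listSum-filter-map P? (λ β → ∣ β ∣ ℤ.≟ ℤ.pred q) (1ℤ Vector.∷_)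
             (pred-sum _) (suc-sum q) T f) ⟩
    listSum (binaryTuples n q) (f ∘ (0ℤ Vector.∷_)) +
    listSum (binaryTuples n (ℤ.pred q)) (f ∘ (1ℤ Vector.∷_)) ∎
    where
    P? : Decidable (λ (β : Vector ℤ (suc n)) → ∣ β ∣ ≡ q)
    P? β = ∣ β ∣ ℤ.≟ q
    T     = tuples (0ℤ ∷ 1ℤ ∷ []) n
    zeros = List.map (0ℤ Vector.∷_) T
    ones  = List.map (1ℤ Vector.∷_) T

  -- Tuples are functions, and the tuples compared below agree only pointwise, so summands must be
  -- known to respect pointwise equality.
  Extensional : ∀ {n} → (Vector ℤ n → Carrier) → Set ℓ
  Extensional f = ∀ {γ δ} → γ ≗ δ → f γ ≈ f δ

  -- Induction on `j`: splitting off the first entry on both sides leaves the same claim for the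
  -- tails.
  ∑-binaryTuples-insertAt : ∀ n q (j : Fin (suc n)) (f : Vector ℤ (suc n) → Carrier) → Extensional f →
    listSum (binaryTuples (suc n) q) f ≈
    (∑[ γ ∈ binaryTuples n q ] f (insertAt γ j 0ℤ)) +
    (∑[ γ ∈ binaryTuples n (ℤ.pred q) ] f (insertAt γ j 1ℤ))
  ∑-binaryTuples-insertAt n q zero f f-ext = R.trans (∑-binaryTuples-suc n q f)
    (+-cong (listSum-cong (binaryTuples n q) λ γ → f-ext λ { zero → refl ; (suc i) → refl })
            (listSum-cong (binaryTuples n (ℤ.pred q)) λ γ → f-ext λ { zero → refl ; (suc i) → refl }))
  ∑-binaryTuples-insertAt (suc n) q (suc j) f f-ext = begin
    listSum (binaryTuples (2 ℕ.+ n) q) f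
      ≈⟨ ∑-binaryTuples-suc (suc n) q f ⟩
    listSum (binaryTuples (suc n) q) (f ∘ (0ℤ Vector.∷_)) +
    listSum (binaryTuples (suc n) (ℤ.pred q)) (f ∘ (1ℤ Vector.∷_))
      ≈⟨ +-cong (∑-binaryTuples-insertAt n q j _ (f-ext ∘ ∷-≗ 0ℤ))
                (∑-binaryTuples-insertAt n (ℤ.pred q) j _ (f-ext ∘ ∷-≗ 1ℤ)) ⟩
    (_ + _) + (_ + _)
      -- The four sums are indexed by the first entry and the entry at `suc j`; regroup them from
      -- the former to the latter.
      ≈⟨ +-interchange _ _ _ _ ⟩
    (_ + _) + (_ + _)
      ≈⟨ +-cong (recombine q 0ℤ) (recombine (ℤ.pred q) 1ℤ) ⟨
    (∑[ γ ∈ binaryTuples (suc n) q ] f (insertAt γ (suc j) 0ℤ)) +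
    (∑[ γ ∈ binaryTuples (suc n) (ℤ.pred q) ] f (insertAt γ (suc j) 1ℤ)) ∎
    where
    recombine : ∀ r b → (∑[ γ ∈ binaryTuples (suc n) r ] f (insertAt γ (suc j) b)) ≈
      (∑[ γ ∈ binaryTuples n r ] f (0ℤ Vector.∷ insertAt γ j b)) +
      (∑[ γ ∈ binaryTuples n (ℤ.pred r) ] f (1ℤ Vector.∷ insertAt γ j b))
    recombine r b = R.trans (∑-binaryTuples-suc n r _)
      (+-cong (listSum-cong (binaryTuples n r) λ γ → f-ext (insertAt-suc 0ℤ γ j b))
              (listSum-cong (binaryTuples n (ℤ.pred r)) λ γ → f-ext (insertAt-suc 1ℤ γ j b)))

  -- Under β = γ ∘ σ the first entry of β is the entry of γ at `σ ⟨$⟩ʳ zero`. Splitting the left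
  -- side by the one and the right side by the other leaves the claim for `remove zero σ`.
  ∑-binaryTuples-permute : ∀ n q (σ : Permutation′ n) (f : Vector ℤ n → Carrier) → Extensional f →
    listSum (binaryTuples n q) f ≈ (∑[ γ ∈ binaryTuples n q ] f (γ ∘ (σ ⟨$⟩ʳ_)))
  ∑-binaryTuples-permute zero    q σ f f-ext = listSum-cong (binaryTuples zero q) λ γ → f-ext λ ()
  ∑-binaryTuples-permute (suc n) q σ f f-ext = begin
    listSum (binaryTuples (suc n) q) f
      ≈⟨ ∑-binaryTuples-suc n q f ⟩
    listSum (binaryTuples n q) (f ∘ (0ℤ Vector.∷_)) +
    listSum (binaryTuples n (ℤ.pred q)) (f ∘ (1ℤ Vector.∷_))
      ≈⟨ +-cong (onTail q 0ℤ) (onTail (ℤ.pred q) 1ℤ) ⟩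
    (∑[ γ ∈ binaryTuples n q ] f (insertAt γ (σ ⟨$⟩ʳ zero) 0ℤ ∘ (σ ⟨$⟩ʳ_))) +
    (∑[ γ ∈ binaryTuples n (ℤ.pred q) ] f (insertAt γ (σ ⟨$⟩ʳ zero) 1ℤ ∘ (σ ⟨$⟩ʳ_)))
      ≈⟨ ∑-binaryTuples-insertAt n q (σ ⟨$⟩ʳ zero) _ (λ γ≗δ → f-ext (γ≗δ ∘ (σ ⟨$⟩ʳ_))) ⟨
    (∑[ γ ∈ binaryTuples (suc n) q ] f (γ ∘ (σ ⟨$⟩ʳ_))) ∎
    where
    onTail : ∀ r b → (∑[ γ ∈ binaryTuples n r ] f (b Vector.∷ γ)) ≈
      (∑[ γ ∈ binaryTuples n r ] f (insertAt γ (σ ⟨$⟩ʳ zero) b ∘ (σ ⟨$⟩ʳ_)))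
    onTail r b = R.trans
      (∑-binaryTuples-permute n r (remove zero σ) (f ∘ (b Vector.∷_)) (f-ext ∘ ∷-≗ b))
      (listSum-cong (binaryTuples n r) λ γ → f-ext (sym ∘ insertAt-permute σ γ b))

  -- Entries at most 1 cannot sum to more than the length. After the first entry is removed, the
  -- remaining sum, `q` or `ℤ.pred q`, still exceeds the remaining length.
  ∑-binaryTuples-> : ∀ n {q} (f : Vector ℤ n → Carrier) → ℤ.+ n ℤ.< q →
    listSum (binaryTuples n q) f ≈ 0#
  ∑-binaryTuples-> zero    {q} f 0<q with 0ℤ ℤ.≟ q
  ... | yes refl = contradiction 0<q (ℤ.<-irrefl refl)
  ... | no  _    = R.refl
  ∑-binaryTuples-> (suc n) {q} f n<q = R.trans (∑-binaryTuples-suc n q f) (R.trans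
    (+-cong (∑-binaryTuples-> n _ (ℤ.<-trans (ℤ.+<+ (ℕ.n<1+n n)) n<q))
            (∑-binaryTuples-> n _ (ℤ.+-monoʳ-< ℤ.-1ℤ n<q)))
    (R.+-identityˡ 0#))

  -- Sums of functions that vanish on tuples with a descent.

  VanishesOnDescents : ∀ {n} → (Vector ℤ n → Carrier) → Set ℓ
  VanishesOnDescents f = ∀ γ → HasDescent γ → f γ ≈ 0#

  -- After a leading 1, only the tail of all ones avoids a descent, and its sum `n` is excluded. A
  -- tail that starts with 0 gives a descent at once; one that starts with 1 is handled by
  -- induction.
  ∑-binaryTuples-1∷ : ∀ n {q} (f : Vector ℤ (suc n) → Carrier) → VanishesOnDescents f →
    q ≢ ℤ.+ n → (∑[ γ ∈ binaryTuples n q ] f (1ℤ Vector.∷ γ)) ≈ 0#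
  ∑-binaryTuples-1∷ zero    {q} f f-desc q≢0 with 0ℤ ℤ.≟ q
  ... | yes 0≡q = contradiction (sym 0≡q) q≢0
  ... | no  _   = R.refl
  ∑-binaryTuples-1∷ (suc n) {q} f f-desc q≢n = R.trans (∑-binaryTuples-suc n q _) (R.trans
    (+-cong (listSum-≈0 (binaryTuples n q) λ γ → f-desc _ (zero , suc zero , here , refl , refl))
            (∑-binaryTuples-1∷ n (f ∘ (1ℤ Vector.∷_)) (λ γ d → f-desc _ (∷-hasDescent 1ℤ {γ} d))
              (λ eq → q≢n (sym (suc-sum q (sym eq))))))
    (R.+-identityˡ 0#))

  -- The first entry is forced. While zeros remain to be placed, a leading 1 would need a tail of
  -- ones only, whose sum is too large. Once none remain, a leading 0 would leave too few entries to
  -- reach the sum.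
  ∑-binaryTuples-vanishing : ∀ m p (f : Vector ℤ (m ℕ.+ p) → Carrier) → Extensional f →
    VanishesOnDescents f →
    listSum (binaryTuples (m ℕ.+ p) (ℤ.+ p)) f ≈ f (replicate m 0ℤ Vector.++ replicate p 1ℤ)
  ∑-binaryTuples-vanishing zero zero f f-ext f-desc =
    R.trans (R.+-identityʳ _) (f-ext λ ())
  ∑-binaryTuples-vanishing zero (suc p) f f-ext f-desc = begin
    listSum (binaryTuples (suc p) (ℤ.+ suc p)) f
      ≈⟨ ∑-binaryTuples-suc p (ℤ.+ suc p) f ⟩
    listSum (binaryTuples p (ℤ.+ suc p)) (f ∘ (0ℤ Vector.∷_)) +
    listSum (binaryTuples p (ℤ.+ p)) (f ∘ (1ℤ Vector.∷_))
      ≈⟨ +-cong (∑-binaryTuples-> p _ (ℤ.+<+ (ℕ.n<1+n p)))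
                (∑-binaryTuples-vanishing zero p (f ∘ (1ℤ Vector.∷_)) (f-ext ∘ ∷-≗ 1ℤ)
                  (λ γ d → f-desc _ (∷-hasDescent 1ℤ {γ} d))) ⟩
    0# + f (1ℤ Vector.∷ (replicate zero 0ℤ Vector.++ replicate p 1ℤ))
      ≈⟨ R.+-identityˡ _ ⟩
    f (1ℤ Vector.∷ (replicate zero 0ℤ Vector.++ replicate p 1ℤ))
      ≈⟨ f-ext (λ { zero → refl ; (suc i) → refl }) ⟩
    f (replicate zero 0ℤ Vector.++ replicate (suc p) 1ℤ) ∎
  ∑-binaryTuples-vanishing (suc m) p f f-ext f-desc = begin
    listSum (binaryTuples (suc m ℕ.+ p) (ℤ.+ p)) f
      ≈⟨ ∑-binaryTuples-suc (m ℕ.+ p) (ℤ.+ p) f ⟩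
    listSum (binaryTuples (m ℕ.+ p) (ℤ.+ p)) (f ∘ (0ℤ Vector.∷_)) +
    listSum (binaryTuples (m ℕ.+ p) (ℤ.pred (ℤ.+ p))) (f ∘ (1ℤ Vector.∷_))
      ≈⟨ +-cong (∑-binaryTuples-vanishing m p (f ∘ (0ℤ Vector.∷_)) (f-ext ∘ ∷-≗ 0ℤ)
                  (λ γ d → f-desc _ (∷-hasDescent 0ℤ {γ} d)))
                (∑-binaryTuples-1∷ (m ℕ.+ p) f f-desc pred-p≢m+p) ⟩
    f (0ℤ Vector.∷ (replicate m 0ℤ Vector.++ replicate p 1ℤ)) + 0#
      ≈⟨ R.+-identityʳ _ ⟩
    f (0ℤ Vector.∷ (replicate m 0ℤ Vector.++ replicate p 1ℤ))
      ≈⟨ f-ext 0∷ ⟩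
    f (replicate (suc m) 0ℤ Vector.++ replicate p 1ℤ) ∎
    where
    pred-p≢m+p : ℤ.pred (ℤ.+ p) ≢ ℤ.+ (m ℕ.+ p)
    -- Equality would give p = 1 + m + p.
    pred-p≢m+p eq = ℕ.<⇒≢ (s≤s (ℕ.m≤n+m p m)) (ℤ.+-injective (sym (suc-sum (ℤ.+ p) (sym eq))))

    0∷ : (0ℤ Vector.∷ (replicate m 0ℤ Vector.++ replicate p 1ℤ)) ≗
         (replicate (suc m) 0ℤ Vector.++ replicate p 1ℤ)
    0∷ zero    = refl
    -- `_++_` looks up its entries through `splitAt`, so both sides compute only once its outcome is
    -- known.
    0∷ (suc i) with splitAt m i
    ... | inj₁ _ = refl
    ... | inj₂ _ = refl

  -- Laplace expansion and row-determinants with two equal adjacent columns.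

  orderedProduct-cong : ∀ {n} {x y : Vector Carrier n} → (∀ i → x i ≈ y i) →
    orderedProduct x ≈ orderedProduct y
  orderedProduct-cong {zero}  x≈y = R.refl
  orderedProduct-cong {suc n} x≈y = *-cong (x≈y zero) (orderedProduct-cong (x≈y ∘ suc))

  rowdet-cong : ∀ {n} {A B : Fin n → Fin n → Carrier} → (∀ i j → A i j ≈ B i j) → rowdet A ≈ rowdet B
  rowdet-cong {n} A≈B = listSum-cong (permutations n) λ σ →
    *-congˡ (orderedProduct-cong λ i → A≈B i (σ ⟨$⟩ʳ i))

  -- Although `R` may be noncommutative, signs can be moved past matrix entries; the Laplace
  -- expansion commutes nothing else.
  [-1]^-central : ∀ k x → (- 1#) ^ k * x ≈ x * (- 1#) ^ k
  [-1]^-central zero    x = R.trans (R.*-identityˡ x) (R.sym (R.*-identityʳ x))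
  [-1]^-central (suc k) x = begin
    - 1# * (- 1#) ^ k * x   ≈⟨ R.*-assoc _ _ _ ⟩
    - 1# * ((- 1#) ^ k * x) ≈⟨ *-congˡ ([-1]^-central k x) ⟩
    - 1# * (x * (- 1#) ^ k) ≈⟨ R.*-assoc _ _ _ ⟨
    - 1# * x * (- 1#) ^ k   ≈⟨ *-congʳ -1-central ⟩
    x * - 1# * (- 1#) ^ k   ≈⟨ R.*-assoc _ _ _ ⟩
    x * (- 1# * (- 1#) ^ k) ∎
    where
    -1-central : - 1# * x ≈ x * - 1#
    -1-central = R.trans (-1*x≈-x x) (R.trans (R.-‿cong (R.sym (R.*-identityʳ x))) (-‿distribʳ-* x 1#))

  -- `permutations` is built by choosing the image `j` of `zero`, so the sum splits by `j`. The
  -- entry from the first row is already the leftmost factor of each product, so the order of the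
  -- entries never changes.
  rowdet-laplace : ∀ {n} (A : Fin (suc n) → Fin (suc n) → Carrier) →
    rowdet A ≈ sum (λ j → ((- 1#) ^ toℕ j * A zero j) * rowdet (λ i k → A (suc i) (punchIn j k)))
  rowdet-laplace {n} A = begin
    rowdet A
      ≈⟨ listSum-cartesianProductWith (insert zero) (allFin (suc n)) (permutations n) _ ⟩
    listSum (allFin (suc n)) expansion
      ≈⟨ listSum-tabulate id expansion ⟩
    sum expansion
      ≈⟨ sum-cong-≋ (λ j → R.trans (listSum-cong (permutations n) λ π → factor j π (minorProduct j π))
           (R.sym (*-distribˡ-listSum (permutations n) _ _))) ⟩
    sum (λ j → ((- 1#) ^ toℕ j * A zero j) * rowdet (λ i k → A (suc i) (punchIn j k))) ∎
    where
    minorProduct : Fin (suc n) → Permutation′ n → Carrier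
    minorProduct j π = orderedProduct (λ i → A (suc i) (punchIn j (π ⟨$⟩ʳ i)))

    expansion : Fin (suc n) → Carrier
    expansion j = ∑[ π ∈ permutations n ] (sgn (insert zero j π) * (A zero j * minorProduct j π))

    factor : ∀ j (π : Permutation′ n) x →
      sgn (insert zero j π) * (A zero j * x) ≈ ((- 1#) ^ toℕ j * A zero j) * (sgn π * x)
    factor j π x = begin
      sgn (insert zero j π) * (A zero j * x)
        ≈⟨ *-congʳ (R.trans (^-congʳ (- 1#) (length-inversions-insert j π)) (^-homo-* (- 1#) (toℕ j) _)) ⟩
      ((- 1#) ^ toℕ j * sgn π) * (A zero j * x)
        ≈⟨ R.*-assoc _ _ _ ⟩
      (- 1#) ^ toℕ j * (sgn π * (A zero j * x))
        ≈⟨ *-congˡ (R.*-assoc _ _ _) ⟨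
      (- 1#) ^ toℕ j * ((sgn π * A zero j) * x)
        ≈⟨ *-congˡ (*-congʳ ([-1]^-central (length (inversions π)) (A zero j))) ⟩
      (- 1#) ^ toℕ j * ((A zero j * sgn π) * x)
        ≈⟨ *-congˡ (R.*-assoc _ _ _) ⟩
      (- 1#) ^ toℕ j * (A zero j * (sgn π * x))
        ≈⟨ R.*-assoc _ _ _ ⟨
      ((- 1#) ^ toℕ j * A zero j) * (sgn π * x) ∎

  sum-adjacent : ∀ {n} {i j : Fin n} → Adjacent i j → (x : Vector Carrier n) →
    (∀ k → k ≢ i → k ≢ j → x k ≈ 0#) → sum x ≈ x i + x j
  sum-adjacent {suc (suc n)} here x x≈0 = +-congˡ (R.trans
    (+-congˡ (R.trans (sum-cong-≋ λ k → x≈0 (suc (suc k)) (λ ()) λ ()) (sum-replicate-zero n)))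
    (R.+-identityʳ _))
  sum-adjacent (there a) x x≈0 = R.trans
    (+-cong (x≈0 zero (λ ()) λ ())
            (sum-adjacent a (x ∘ suc) λ k k≢i k≢j →
              x≈0 (suc k) (k≢i ∘ Fin.suc-injective) (k≢j ∘ Fin.suc-injective)))
    (R.+-identityˡ _)

  -- In the Laplace expansion, deleting any column other than `i` and `j` leaves a minor with two
  -- equal adjacent columns, which vanishes by induction. The two remaining terms have equal entries
  -- and equal minors but opposite signs.
  rowdet-adjacent : ∀ {n} {i j : Fin n} → Adjacent i j → (A : Fin n → Fin n → Carrier) →
    (∀ r → A r i ≈ A r j) → rowdet A ≈ 0#
  rowdet-adjacent {suc n} {i} {j} a A Ai≈Aj = begin
    rowdet A                  ≈⟨ rowdet-laplace A ⟩
    sum term                  ≈⟨ sum-adjacent a term others ⟩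
    term i + term j           ≈⟨ +-congʳ term-i ⟩
    - term j + term j         ≈⟨ R.-‿inverseˡ (term j) ⟩
    0#                        ∎
    where
    minor : Fin (suc n) → Fin n → Fin n → Carrier
    minor k r s = A (suc r) (punchIn k s)

    term : Fin (suc n) → Carrier
    term k = ((- 1#) ^ toℕ k * A zero k) * rowdet (minor k)

    others : ∀ k → k ≢ i → k ≢ j → term k ≈ 0#
    others k k≢i k≢j with adjacentAfter k a
    ... | isLeft   = contradiction refl k≢i
    ... | isRight  = contradiction refl k≢j
    ... | avoids b = R.trans (*-congˡ (rowdet-adjacent b (minor k) (Ai≈Aj ∘ suc))) (R.zeroʳ _)

    minors : ∀ r s → minor i r s ≈ minor j r s
    minors r s with punchIn-adjacent a s
    ... | inj₁ eq = R.reflexive (cong (A (suc r)) eq)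
    ... | inj₂ (eqⱼ , eqᵢ) = begin
      A (suc r) (punchIn i s) ≡⟨ cong (A (suc r)) eqⱼ ⟩
      A (suc r) j             ≈⟨ Ai≈Aj (suc r) ⟨
      A (suc r) i             ≡⟨ cong (A (suc r)) eqᵢ ⟨
      A (suc r) (punchIn j s) ∎

    term-i : term i ≈ - term j
    term-i = begin
      ((- 1#) ^ toℕ i * A zero i) * rowdet (minor i)
        ≈⟨ *-cong (*-congˡ (Ai≈Aj zero)) (rowdet-cong minors) ⟩
      -- The double negation supplies the factor `- 1#` by which the sign at `j`, the successor of
      -- `i`, differs from the sign at `i`.
      x                         ≈⟨ -‿involutive x ⟨
      - (- x)                   ≈⟨ R.-‿cong (-1*x≈-x x) ⟨
      - (- 1# * x)
        ≈⟨ R.-‿cong (R.trans (R.sym (R.*-assoc _ _ _)) (*-congʳ (R.sym (R.*-assoc _ _ _)))) ⟩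
      - (((- 1#) ^ suc (toℕ i) * A zero j) * rowdet (minor j))
        ≡⟨ cong (λ k → - (((- 1#) ^ k * A zero j) * rowdet (minor j))) (toℕ-adjacent a) ⟨
      - term j ∎
      where
      x = ((- 1#) ^ toℕ i * A zero j) * rowdet (minor j)

  -- From shifted rows to shifted columns.

  module _ {n} (h : ℤ → Fin n → Carrier) (α : Vector ℤ n) where

    -- The bracketing keeps the column index and its shift together, so that zeros followed by ones
    -- turn them into `ξ` by computation.
    shiftedColumns : Vector ℤ n → Carrier
    shiftedColumns γ = rowdet (λ i j → h (α i ℤ.+ ((1⋯ n) j ℤ.+ γ j)) i)

    shiftedColumns-ext : Extensional shiftedColumns
    shiftedColumns-ext γ≗δ = rowdet-cong λ i j →
      R.reflexive (cong (λ z → h (α i ℤ.+ ((1⋯ n) j ℤ.+ z)) i) (γ≗δ j))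

    -- At a descent the left column is moved one step to the right, onto its unmoved neighbour, so
    -- the two columns coincide.
    shiftedColumns-vanishes : VanishesOnDescents shiftedColumns
    shiftedColumns-vanishes γ (i , j , a , γi≡1 , γj≡0) = rowdet-adjacent a _ λ r →
      R.reflexive (cong (λ z → h (α r ℤ.+ z) r) columns)
      where
      columns : (1⋯ n) i ℤ.+ γ i ≡ (1⋯ n) j ℤ.+ γ j
      columns rewrite γi≡1 | γj≡0 | toℕ-adjacent a =
        cong ℤ.+_ (trans (ℕ.+-comm (suc (toℕ i)) 1) (sym (ℕ.+-identityʳ _)))

    ∑-t≈∑-shiftedColumns : ∀ q →
      (∑[ β ∈ binaryTuples n q ] t h (α ⊕ β)) ≈ listSum (binaryTuples n q) shiftedColumns
    ∑-t≈∑-shiftedColumns q = begin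
      (∑[ β ∈ binaryTuples n q ] ∑[ σ ∈ permutations n ] rowTerm σ β)
        -- The substitution β = γ ∘ σ depends on σ, so the sum over σ has to be the outer one while
        -- it is made.
        ≈⟨ listSum-comm (binaryTuples n q) (permutations n) _ ⟩
      (∑[ σ ∈ permutations n ] ∑[ β ∈ binaryTuples n q ] rowTerm σ β)
        ≈⟨ listSum-cong (permutations n) (λ σ → R.trans
             (∑-binaryTuples-permute n q σ (rowTerm σ) (rowTerm-ext σ))
             (listSum-cong (binaryTuples n q) λ γ → *-congˡ (orderedProduct-cong λ i →
               R.reflexive (cong (λ z → h z i) (regroup (α i) (γ (σ ⟨$⟩ʳ i)) _))))) ⟩
      (∑[ σ ∈ permutations n ] ∑[ γ ∈ binaryTuples n q ] columnTerm σ γ)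
        ≈⟨ listSum-comm (binaryTuples n q) (permutations n) _ ⟨
      listSum (binaryTuples n q) shiftedColumns ∎
      where
      rowTerm columnTerm : Permutation′ n → Vector ℤ n → Carrier
      rowTerm    σ β = sgn σ * orderedProduct (λ i → h (α i ℤ.+ β i ℤ.+ (1⋯ n) (σ ⟨$⟩ʳ i)) i)
      columnTerm σ γ = sgn σ * orderedProduct
        (λ i → h (α i ℤ.+ ((1⋯ n) (σ ⟨$⟩ʳ i) ℤ.+ γ (σ ⟨$⟩ʳ i))) i)

      rowTerm-ext : ∀ σ → Extensional (rowTerm σ)
      rowTerm-ext σ γ≗δ = *-congˡ (orderedProduct-cong λ i →
        R.reflexive (cong (λ z → h (α i ℤ.+ z ℤ.+ (1⋯ n) (σ ⟨$⟩ʳ i)) i) (γ≗δ i)))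

      regroup : ∀ a b k → a ℤ.+ b ℤ.+ k ≡ a ℤ.+ (k ℤ.+ b)
      regroup a b k = trans (ℤ.+-assoc a b k) (cong (λ z → a ℤ.+ z) (ℤ.+-comm b k))

  -- With `m` a variable in place of `n ∸ p`, the length equation can be matched with `refl`, and
  -- the cast becomes the identity.
  ∑-binaryTuples-vanishing-cast : ∀ {n} m p (m+p≡n : m ℕ.+ p ≡ n) (f : Vector ℤ n → Carrier) →
    Extensional f → VanishesOnDescents f →
    listSum (binaryTuples n (ℤ.+ p)) f ≈
    f (rearrange (cast (sym m+p≡n)) (replicate m 0ℤ Vector.++ replicate p 1ℤ))
  ∑-binaryTuples-vanishing-cast m p refl f f-ext f-desc = R.trans
    (∑-binaryTuples-vanishing m p f f-ext f-desc)
    (f-ext λ i → sym (cong (replicate m 0ℤ Vector.++ replicate p 1ℤ) (Fin.cast-is-id refl i)))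

theorem4p1 : ∀ {c ℓ} (R : Ring c ℓ) →
    let open Ring R
        open RowDeterminant R
    in
    (n p : ℕ) (p≤n : p ≤ n) (h : ℤ → Fin n → Carrier) (α : Vector ℤ n) →
    (∑[ β ∈ binaryTuplesOfSum n p ] t h (α ⊕ β))
      ≈ rowdet (λ i j → h (α i ℤ.+ ξ n p p≤n j) i)
theorem4p1 R n p p≤n h α = Ring.trans R
  -- `binaryTuplesOfSum n p` unfolds to `binaryTuples n (ℤ.+ p)`, and the value of `shiftedColumns`
  -- reached in the second step unfolds to the row-determinant with `ξ`.
  (∑-t≈∑-shiftedColumns R h α (ℤ.+ p))
  (∑-binaryTuples-vanishing-cast R (n ∸ p) p (ℕ.m∸n+n≡m p≤n)
    (shiftedColumns R h α) (shiftedColumns-ext R h α) (shiftedColumns-vanishes R h α))
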